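{- Let $G$ be a finite simple connected graph and let $n$ be a positive integer. If $|C(G)|<\binom{n}{3}$, then $\max(\chi(G),h(G))<n$.
   Context: All graphs are finite and simple. $C(G)$ denotes the set of all induced cycles in $G$ (induced subgraphs of $G$ that are cycles, of length at least 3). $\chi(G)$ is the chromatic number, and the Hadwiger number $h(G)$ is the maximum $t$ such that the complete graph $K^{t}$ is a minor of $G$. -}

module Defs where

open import Data.Fin using (Fin; zero; suc; toℕ; fromℕ<)
import Data.Fin.Properties as Fin
open import Data.Fin.Subset using (Subset; inside; outside; _∈_; Nonempty; ⊤)
open import Data.Fin.Subset.Properties using (_∈?_; nonempty?; anySubset?)
open import Data.List using (List; []; _∷_; _++_; length; filter)
import Data.List as List
open import Data.Nat using (ℕ; zero; suc; _+_; _≤_; _<_; z≤n; s≤s)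
import Data.Nat.Properties as ℕ
open import Data.Product using (∃; _×_; _,_; proj₁; proj₂)
open import Data.Sum using (_⊎_; inj₁; inj₂; [_,_]; swap)
open import Data.Vec using ([]; _∷_)
open import Data.Vec.Functional using (Vector; head; tail) renaming ([] to []ᶠ; _∷_ to _∷ᶠ_)
open import Function using (_∘_; id; Injective; _⇔_; mk⇔; Equivalence)
open import Level using (0ℓ)
open import Relation.Binary using (Rel; Symmetric; Irreflexive; Decidable)
open import Relation.Binary.Construct.Closure.ReflexiveTransitive using (Star; ε; _◅_; _◅◅_)
open import Relation.Binary.PropositionalEquality
  using (_≡_; _≢_; _≗_; refl; sym; trans; subst; subst₂; ≢-sym)
open import Relation.Nullary using (Dec; yes; no; ¬_; ¬?; contradiction)
open import Relation.Nullary.Decidable using (map′; _×-dec_; _⊎-dec_; _→-dec_)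
open import Relation.Unary using (Pred) renaming (Decidable to Decidable₁)

record Graph : Set₁ where
  infix 4 _~_ _~?_
  field
    order    : ℕ
    _~_      : Rel (Fin order) 0ℓ
    ~-sym    : Symmetric _~_
    ~-irrefl : Irreflexive _≡_ _~_
    _~?_     : Decidable _~_

open Graph public using (order)

V : Graph → Set
V G = Fin (order G)

K : ℕ → Graph
K t = record
  { order    = t
  ; _~_      = _≢_
  ; ~-sym    = ≢-sym
  ; ~-irrefl = λ x≡y x≢y → x≢y x≡y
  ; _~?_     = λ x y → ¬? (x Fin.≟ y)
  }

-- j is the cyclic successor of i.
Next : ∀ {k} → Rel (Fin (3 + k)) 0ℓ
Next {k} i j = toℕ j ≡ suc (toℕ i) ⊎ (toℕ i ≡ 2 + k × toℕ j ≡ 0)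

private
  next? : ∀ {k} → Decidable (Next {k})
  next? {k} i j = (toℕ j ℕ.≟ suc (toℕ i)) ⊎-dec ((toℕ i ℕ.≟ 2 + k) ×-dec (toℕ j ℕ.≟ 0))

  next-irrefl : ∀ {k} (i : Fin (3 + k)) → ¬ Next i i
  next-irrefl i (inj₁ eq)        = ℕ.1+n≢n (sym eq)
  next-irrefl i (inj₂ (eq , eq′)) with () ← trans (sym eq) eq′

Cycle[3+_] : ℕ → Graph
Cycle[3+ k ] = record
  { order    = 3 + k
  ; _~_      = λ i j → Next i j ⊎ Next j i
  ; ~-sym    = swap
  ; ~-irrefl = λ { {i} refl → [ next-irrefl i , next-irrefl i ] }
  ; _~?_     = λ i j → next? i j ⊎-dec next? j i
  }

module _ (G : Graph) where
  open Graph G using (_~_)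

  Adj[_] : Subset (order G) → Rel (V G) 0ℓ
  Adj[ S ] u v = u ∈ S × v ∈ S × u ~ v

  -- The induced subgraph G[S] is connected; a connected graph is nonempty.
  ConnectedOn : Subset (order G) → Set
  ConnectedOn S = Nonempty S × (∀ u v → u ∈ S → v ∈ S → Star Adj[ S ] u v)

  Connected : Set
  Connected = ConnectedOn ⊤

  -- f is an isomorphism from H onto the induced subgraph G[S].
  IsIsoOnto : (S : Subset (order G)) (H : Graph) → (V H → V G) → Set
  IsIsoOnto S H f =
    Injective _≡_ _≡_ f ×
    (∀ v → v ∈ S ⇔ ∃ λ x → f x ≡ v) ×
    (∀ x y → Graph._~_ H x y ⇔ f x ~ f y)

  -- An induced subgraph is determined by its vertex set, so the elements
  -- of C(G) are represented by the vertex sets S for which G[S] is a cycle.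
  InducesCycle : Subset (order G) → Set
  InducesCycle S = ∃ λ k → ∃ λ f → IsIsoOnto S Cycle[3+ k ] f

  IsProper : ∀ {k} → (V G → Fin k) → Set
  IsProper c = ∀ u v → u ~ v → c u ≢ c v

  Colourable : ℕ → Set
  Colourable k = ∃ λ (c : V G → Fin k) → IsProper c

-- B x is the branch set of x.
IsModel : (H G : Graph) → (V H → Subset (order G)) → Set
IsModel H G B =
  (∀ x → ConnectedOn G (B x)) ×
  (∀ x y v → v ∈ B x → v ∈ B y → x ≡ y) ×
  (∀ x y → Graph._~_ H x y → ∃ λ u → ∃ λ v → u ∈ B x × v ∈ B y × Graph._~_ G u v)

infix 4 _≼_
_≼_ : Graph → Graph → Set
H ≼ G = ∃ (IsModel H G)

IsLeast IsGreatest : Pred ℕ 0ℓ → Pred ℕ 0ℓ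
IsLeast    P m = P m × (∀ k → P k → m ≤ k)
IsGreatest P m = P m × (∀ k → P k → k ≤ m)

least : ∀ {P : Pred ℕ 0ℓ} → Decidable₁ P → ∀ b → P b → ∃ (IsLeast P)
least P? b Pb with P? 0
... | yes P0 = 0 , P0 , λ _ _ → z≤n
least P? zero    Pb | no ¬P0 = contradiction Pb ¬P0
least P? (suc b) Pb | no ¬P0 with least (P? ∘ suc) b Pb
... | m , Pm , min = suc m , Pm , λ
  { zero    P0 → contradiction P0 ¬P0
  ; (suc k) Pk → s≤s (min k Pk) }

greatest : ∀ {P : Pred ℕ 0ℓ} → Decidable₁ P → P 0 →
           ∀ b → (∀ k → P k → k ≤ b) → ∃ (IsGreatest P)
greatest P? P0 zero    bound = 0 , P0 , bound
greatest P? P0 (suc b) bound with P? (suc b)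
... | yes Pb = suc b , Pb , bound
... | no ¬Pb = greatest P? P0 b λ k Pk →
  ℕ.m<1+n⇒m≤n (ℕ.≤∧≢⇒< (bound k Pk) λ { refl → ¬Pb Pk })

private

  -- Paths all of whose interior vertices have index less than k
  -- (Floyd–Warshall).
  module Reachability {n} {R : Rel (Fin n) 0ℓ} (R? : Decidable R) where

    Via : ∀ k → k ≤ n → Rel (Fin n) 0ℓ
    Via zero    _   i j = i ≡ j ⊎ R i j
    Via (suc k) k<n i j = Via k (ℕ.<⇒≤ k<n) i j ⊎
      (Via k (ℕ.<⇒≤ k<n) i (fromℕ< k<n) × Via k (ℕ.<⇒≤ k<n) (fromℕ< k<n) j)

    via? : ∀ k k≤n → Decidable (Via k k≤n)
    via? zero    _   i j = (i Fin.≟ j) ⊎-dec R? i j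
    via? (suc k) k<n i j = via? k _ i j ⊎-dec (via? k _ i _ ×-dec via? k _ _ j)

    sound : ∀ k k≤n {i j} → Via k k≤n i j → Star R i j
    sound zero    _   (inj₁ refl)    = ε
    sound zero    _   (inj₂ r)       = r ◅ ε
    sound (suc k) k<n (inj₁ p)       = sound k _ p
    sound (suc k) k<n (inj₂ (p , q)) = sound k _ p ◅◅ sound k _ q

    base : ∀ k k≤n {i j} → i ≡ j ⊎ R i j → Via k k≤n i j
    base zero    _   p = p
    base (suc k) k<n p = inj₁ (base k _ p)

    join : ∀ k k≤n {i v j} → toℕ v < k → Via k k≤n i v → Via k k≤n v j → Via k k≤n i j
    join (suc k) k<n {v = v} v≤k p q with toℕ v ℕ.≟ k
    ... | yes v≡k with refl ← Fin.toℕ-injective (trans v≡k (sym (Fin.toℕ-fromℕ< k<n))) =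
      inj₂ ([ id , proj₁ ] p , [ id , proj₂ ] q)
    ... | no v≢k = go p q
      where
      v<k = ℕ.≤∧≢⇒< (ℕ.m<1+n⇒m≤n v≤k) v≢k
      go : ∀ {i j} → Via (suc k) k<n i v → Via (suc k) k<n v j → Via (suc k) k<n i j
      go (inj₁ p)       (inj₁ q)        = inj₁ (join k _ v<k p q)
      go (inj₁ p)       (inj₂ (q , q′)) = inj₂ (join k _ v<k p q , q′)
      go (inj₂ (p , p′)) (inj₁ q)       = inj₂ (p , join k _ v<k p′ q)
      go (inj₂ (p , _)) (inj₂ (_ , q))  = inj₂ (p , q)

    complete : ∀ {i j} → Star R i j → Via n ℕ.≤-refl i j
    complete ε                 = base n _ (inj₁ refl)
    complete (_◅_ {j = v} r p) =
      join n _ (Fin.toℕ<n v) (base n _ (inj₂ r)) (complete p)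

    star? : Decidable (Star R)
    star? i j = map′ (sound n _) complete (via? n ℕ.≤-refl i j)

  _⇔-dec_ : ∀ {A B : Set} → Dec A → Dec B → Dec (A ⇔ B)
  a? ⇔-dec b? = map′ (λ (f , g) → mk⇔ f g)
                     (λ e → Equivalence.to e , Equivalence.from e)
                     ((a? →-dec b?) ×-dec (b? →-dec a?))

  Searchable : Set → Set₁
  Searchable A = ∀ {P : Pred A 0ℓ} → Decidable₁ P → Dec (∃ P)

  any-vector? : ∀ {A} → Searchable A → ∀ {m} {P : Pred (Vector A m) 0ℓ} →
                (∀ {f g} → f ≗ g → P f → P g) → Decidable₁ P → Dec (∃ P)
  any-vector? A? {zero}  resp P? = map′ (λ p → []ᶠ , p) (λ (_ , p) → resp (λ ()) p) (P? []ᶠ)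
  any-vector? A? {suc m} resp P? = map′
    (λ (a , f , p) → a ∷ᶠ f , p)
    (λ (f , p) → head f , tail f , resp (λ { zero → refl ; (suc i) → refl }) p)
    (A? λ a → any-vector? A?
      (λ f≗g → resp λ { zero → refl ; (suc i) → f≗g i }) (λ f → P? (a ∷ᶠ f)))

  injective? : ∀ {m n} → Decidable₁ (λ (f : Fin m → Fin n) → Injective _≡_ _≡_ f)
  injective? f = map′ (λ inj {x} {y} → inj x y) (λ inj x y → inj)
    (Fin.all? λ x → Fin.all? λ y → (f x Fin.≟ f y) →-dec (x Fin.≟ y))

module _ (G : Graph) where
  open Graph G using (_~_; _~?_)

  connectedOn? : Decidable₁ (ConnectedOn G)
  connectedOn? S = nonempty? S ×-dec
    (Fin.all? λ u → Fin.all? λ v → (u ∈? S) →-dec ((v ∈? S) →-dec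
      Reachability.star? (λ x y → (x ∈? S) ×-dec ((y ∈? S) ×-dec (x ~? y))) u v))

  private
    iso? : ∀ S H → Decidable₁ (IsIsoOnto G S H)
    iso? S H f = injective? f ×-dec
      ((Fin.all? λ v → (v ∈? S) ⇔-dec Fin.any? (λ x → f x Fin.≟ v)) ×-dec
      (Fin.all? λ x → Fin.all? λ y → Graph._~?_ H x y ⇔-dec (f x ~? f y)))

    iso-resp : ∀ S H {f g} → f ≗ g → IsIsoOnto G S H f → IsIsoOnto G S H g
    iso-resp S H f≗g (inj , img , adj) =
      (λ {x} {y} eq → inj (trans (f≗g x) (trans eq (sym (f≗g y))))) ,
      (λ v → mk⇔
        (λ v∈S → let x , eq = Equivalence.to (img v) v∈S in x , trans (sym (f≗g x)) eq)
        (λ (x , eq) → Equivalence.from (img v) (x , trans (f≗g x) eq))) ,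
      (λ x y → subst₂ (λ u v → Graph._~_ H x y ⇔ u ~ v) (f≗g x) (f≗g y) (adj x y))

  inducesCycle? : Decidable₁ (InducesCycle G)
  inducesCycle? S = map′ (λ (k , _ , p) → k , p)
    (λ (k , f , p) → k , ℕ.≤-trans (s≤s (ℕ.m≤n+m k 2)) (Fin.injective⇒≤ (proj₁ p)) , f , p)
    (ℕ.anyUpTo? (λ k → any-vector? Fin.any? (iso-resp S Cycle[3+ k ]) (iso? S Cycle[3+ k ]))
      (order G))

  colourable? : Decidable₁ (Colourable G)
  colourable? k = any-vector? Fin.any?
    (λ f≗g p u v u~v eq → p u v u~v (trans (f≗g u) (trans eq (sym (f≗g v)))))
    (λ c → Fin.all? λ u → Fin.all? λ v → (u ~? v) →-dec ¬? (c u Fin.≟ c v))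

  colourable-order : Colourable G (order G)
  colourable-order = id , λ u v u~v u≡v → Graph.~-irrefl G u≡v u~v

_≼?_ : Decidable _≼_
H ≼? G = any-vector? anySubset?
  (λ {B} {B′} B≗B′ (conn , disj , adj) →
    (λ x → subst (ConnectedOn G) (B≗B′ x) (conn x)) ,
    (λ x y v p q → disj x y v (subst (v ∈_) (sym (B≗B′ x)) p) (subst (v ∈_) (sym (B≗B′ y)) q)) ,
    (λ x y x~y → let u , v , p , q , u~v = adj x y x~y in
      u , v , subst (u ∈_) (B≗B′ x) p , subst (v ∈_) (B≗B′ y) q , u~v))
  (λ B → (Fin.all? λ x → connectedOn? G (B x)) ×-dec
    ((Fin.all? λ x → Fin.all? λ y → Fin.all? λ v →
      (v ∈? B x) →-dec ((v ∈? B y) →-dec (x Fin.≟ y))) ×-dec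
    (Fin.all? λ x → Fin.all? λ y → Graph._~?_ H x y →-dec
      (Fin.any? λ u → Fin.any? λ v → (u ∈? B x) ×-dec ((v ∈? B y) ×-dec Graph._~?_ G u v)))))

≼⇒order≤ : ∀ {H G} → H ≼ G → order H ≤ order G
≼⇒order≤ (B , conn , disj , _) = Fin.injective⇒≤ {f = rep} λ {x} {y} eq →
  disj x y (rep x) (rep∈ x) (subst (_∈ B y) (sym eq) (rep∈ y))
  where
  rep  = λ x → proj₁ (proj₁ (conn x))
  rep∈ = λ x → proj₂ (proj₁ (conn x))

K₀≼ : ∀ G → K 0 ≼ G
K₀≼ G = []ᶠ , (λ ()) , (λ ()) , (λ ())

subsets : ∀ n → List (Subset n)
subsets zero    = [] ∷ []
subsets (suc n) = List.map (inside ∷_) (subsets n) ++ List.map (outside ∷_) (subsets n)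

∣C∣ : Graph → ℕ
∣C∣ G = length (filter (inducesCycle? G) (subsets (order G)))

module _ (G : Graph) where

  private
    leastColouring : ∃ (IsLeast (Colourable G))
    leastColouring = least (colourable? G) (order G) (colourable-order G)

    greatestClique : ∃ (IsGreatest (λ t → K t ≼ G))
    greatestClique = greatest (λ t → K t ≼? G) (K₀≼ G) (order G) (λ t → ≼⇒order≤ {K t} {G})

  χ : ℕ
  χ = proj₁ leastColouring

  χ-isLeast : IsLeast (Colourable G) χ
  χ-isLeast = proj₂ leastColouring

  h : ℕ
  h = proj₁ greatestClique

  h-isGreatest : IsGreatest (λ t → K t ≼ G) h
  h-isGreatest = proj₂ greatestClique

{-# OPTIONS --safe #-}

-- Let A, P and Q be pairwise disjoint, A connected.  If a walk in P ∪ Q runs from a neighbour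
-- of A in P to a neighbour of A in Q, then A ∪ P ∪ Q contains an induced cycle meeting A, P
-- and Q.  Hence if A has such links to every two of k disjoint sets, there are k C 2 induced
-- cycles meeting A, told apart by the pair of sets they meet, and Pascal's rule turns k C 3
-- induced cycles avoiding A into (k + 1) C 3.  For a clique minor, A is a branch set and the k
-- sets are the others.  For the chromatic number, A is a vertex v such that the earlier vertices
-- are k-colourable but not together with v; Kempe chains link the colour classes.
module Submission where

open import Defs
open import Data.Empty using (⊥-elim)
open import Data.Fin as Fin using (Fin; zero; suc; toℕ; splitAt; fromℕ<)
import Data.Fin.Properties as Fin
open import Data.Fin.Subset using (Subset; _∈_; inside; outside)
open import Data.Fin.Subset.Properties using (_∈?_)
open import Data.List using (List; []; _∷_; length; filter; lookup)
import Data.List.Membership.Propositional as List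
open import Data.List.Membership.Propositional.Properties
  using (∈-lookup; ∈-++⁺ˡ; ∈-++⁺ʳ; ∈-map⁺; ∈-filter⁺)
open import Data.List.Relation.Unary.All as All using (All; []; _∷_)
open import Data.List.Relation.Unary.Any as Any using (here)
open import Data.List.Relation.Unary.Any.Properties using (lookup-index)
open import Data.Nat using (ℕ; zero; suc; _+_; _≤_; _<_; _⊔_; z≤n; s≤s; _≤′_; ≤′-refl; ≤′-step)
open import Data.Nat.Combinatorics using (_C_; nC1≡n; nCk+nC[k+1]≡[n+1]C[k+1])
import Data.Nat.Properties as ℕ
open import Data.Product using (∃; ∃₂; _×_; _,_; proj₁; proj₂)
open import Data.Sum as Sum using (_⊎_; inj₁; inj₂; [_,_]′; swap)
open import Data.Vec using ([]; _∷_; tabulate)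
open import Data.Vec.Properties using ([]=⇒lookup; lookup⇒[]=; lookup∘tabulate)
open import Effect.Monad using (RawMonad)
open import Function using (_∘_; _∘′_; Injective; _⇔_; mk⇔)
open import Level using (0ℓ)
open import Relation.Binary using (Rel)
open import Relation.Binary.Construct.Closure.ReflexiveTransitive as Star
  using (Star; ε; _◅_; _◅◅_)
open import Relation.Binary.PropositionalEquality
  using (_≡_; _≢_; refl; sym; trans; cong; subst)
open import Relation.Nullary using (Dec; yes; no; ¬_; ¬?; does; contradiction)
open import Relation.Nullary.Decidable
  using (dec-true; decidable-stable; ¬¬-excluded-middle; _×-dec_; _⊎-dec_)
open import Relation.Nullary.Negation using (¬¬-Monad)
open import Relation.Unary using (Pred; Decidable; ∁; ｛_｝; _∪_; _∩_; _⊆_; _≬_)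

-- Subsets cut out by decidable predicates.

fromPred : ∀ {n} {P : Pred (Fin n) 0ℓ} → Decidable P → Subset n
fromPred P? = tabulate (does ∘ P?)

∈-fromPred⁺ : ∀ {n} {P : Pred (Fin n) 0ℓ} (P? : Decidable P) {v} → P v → v ∈ fromPred P?
∈-fromPred⁺ P? {v} p =
  lookup⇒[]= v _ (trans (lookup∘tabulate _ v) (dec-true (P? v) p))

∈-fromPred⁻ : ∀ {n} {P : Pred (Fin n) 0ℓ} (P? : Decidable P) {v} → v ∈ fromPred P? → P v
∈-fromPred⁻ P? {v} v∈ with P? v | trans (sym (lookup∘tabulate (does ∘ P?) v)) ([]=⇒lookup v∈)
... | yes p | _ = p

-- Induced paths, and induced cycles through a vertex.

module _ (G : Graph) where
  open Graph G using (_~_; ~-sym; ~-irrefl; _~?_)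

  AdjIn : Pred (V G) 0ℓ → Rel (V G) 0ℓ
  AdjIn X u v = X u × X v × u ~ v

  Walk : Pred (V G) 0ℓ → Rel (V G) 0ℓ
  Walk X = Star (AdjIn X)

  walk-mono : ∀ {X Y} → X ⊆ Y → ∀ {u v} → Walk X u v → Walk Y u v
  walk-mono X⊆Y = Star.map λ (x , y , e) → X⊆Y x , X⊆Y y , e

  module _ (z : V G) (W : Pred (V G) 0ℓ) where

    -- Path x xs: the vertices x ∷ xs form an induced path, and its last vertex
    -- is the only one in W adjacent to z.
    data Path : V G → List (V G) → Set where
      stop : ∀ {x} → W x → z ~ x → Path x []
      step : ∀ {x y ys} → ¬ (W x × z ~ x) → x ~ y →
             All (∁ (λ u → x ~ u ⊎ x ≡ u)) ys → Path y ys → Path x (y ∷ ys)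

    -- The search runs from the far end, so the suffix starts at the last vertex in `D`. This serves
    -- both to shortcut a walk and to choose where a cycle leaves `z`.
    suffix : ∀ {X D : Pred (V G) 0ℓ} → Decidable D → ∀ {y ys} → Path y ys → All X (y ∷ ys) →
             (∃₂ λ x xs → Path x xs × All X (x ∷ xs) × D x × All (∁ D) xs) ⊎ All (∁ D) (y ∷ ys)
    suffix D? {y} π@(stop _ _) px with D? y
    ... | yes d = inj₁ (_ , _ , π , px , d , [])
    ... | no ¬d = inj₂ (¬d ∷ [])
    suffix D? {y} π@(step _ _ _ π′) (p ∷ ps) with suffix D? π′ ps
    ... | inj₁ found = inj₁ found
    ... | inj₂ none with D? y
    ...   | yes d = inj₁ (_ , _ , π , p ∷ ps , d , none)
    ...   | no ¬d = inj₂ (¬d ∷ none)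

    -- The walk is cut at its first vertex in `W` adjacent to `z`. Going backwards, the induced path
    -- built from the rest is cut down to its last vertex equal or adjacent to `x`, and `x` is put
    -- in front unless it is already there.
    walk⇒path : Decidable W → ∀ {X x y} → X x → Walk X x y → W y → z ~ y →
                ∃ λ xs → Path x xs × All X (x ∷ xs)
    walk⇒path W? Xx ε w z~y = [] , stop w z~y , Xx ∷ []
    walk⇒path W? {x = x} Xx ((_ , Xx′ , x~x′) ◅ walk) w z~y with W? x ×-dec (z ~? x)
    ... | yes (Wx , z~x) = [] , stop Wx z~x , Xx ∷ []
    ... | no ¬t with walk⇒path W? Xx′ walk w z~y
    ...   | ys , π , all with suffix (λ u → (x ~? u) ⊎-dec (x Fin.≟ u)) π all
    ...     | inj₁ (_ , _ , π′ , all′ , inj₁ x~y , none) = _ , step ¬t x~y none π′ , Xx ∷ all′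
    ...     | inj₁ (_ , xs , π′ , all′ , inj₂ refl , _)  = xs , π′ , all′
    ...     | inj₂ (¬x~x′ ∷ _)                           = contradiction (inj₁ x~x′) ¬x~x′

    path-injective : ∀ {x xs} → Path x xs → Injective _≡_ _≡_ (lookup (x ∷ xs))
    path-injective π {zero} {zero} _ = refl
    path-injective (step _ x~y _ _)    {zero} {suc zero}    eq = ⊥-elim (~-irrefl eq x~y)
    path-injective (step _ _ none _)   {zero} {suc (suc j)} eq =
      ⊥-elim (All.lookup none (∈-lookup j) (inj₂ eq))
    path-injective (step _ x~y _ _)    {suc zero} {zero}    eq = ⊥-elim (~-irrefl (sym eq) x~y)
    path-injective (step _ _ none _)   {suc (suc i)} {zero} eq =
      ⊥-elim (All.lookup none (∈-lookup i) (inj₂ (sym eq)))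
    path-injective (step _ _ _ π)      {suc i} {suc j} eq = cong suc (path-injective π eq)

    path-~⁺ : ∀ {x xs} → Path x xs → ∀ i j → toℕ j ≡ suc (toℕ i) →
              lookup (x ∷ xs) i ~ lookup (x ∷ xs) j
    path-~⁺ (step _ x~y _ _) zero    (suc zero) eq = x~y
    path-~⁺ (step _ _ _ π)   (suc i) (suc j)    eq = path-~⁺ π i j (ℕ.suc-injective eq)

    path-~⁻ : ∀ {x xs} → Path x xs → ∀ i j → lookup (x ∷ xs) i ~ lookup (x ∷ xs) j →
              toℕ j ≡ suc (toℕ i) ⊎ toℕ i ≡ suc (toℕ j)
    path-~⁻ π zero zero e = ⊥-elim (~-irrefl refl e)
    path-~⁻ (step _ _ _ _) zero (suc zero) e = inj₁ refl
    path-~⁻ (step _ _ _ _) (suc zero) zero e = inj₂ refl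
    path-~⁻ (step _ _ none _) zero (suc (suc j)) e =
      ⊥-elim (All.lookup none (∈-lookup j) (inj₁ e))
    path-~⁻ (step _ _ none _) (suc (suc i)) zero e =
      ⊥-elim (All.lookup none (∈-lookup i) (inj₁ (~-sym e)))
    path-~⁻ (step _ _ _ π) (suc i) (suc j) e = Sum.map (cong suc) (cong suc) (path-~⁻ π i j e)

    path-end⁺ : ∀ {x xs} → Path x xs → ∀ i → toℕ i ≡ length xs → z ~ lookup (x ∷ xs) i
    path-end⁺ (stop _ z~x)   zero    eq = z~x
    path-end⁺ (step _ _ _ π) (suc i) eq = path-end⁺ π i (ℕ.suc-injective eq)

    -- `step` excludes only those neighbours of `z` that lie in `W`; the `All` hypothesis turns this
    -- into the exclusion of every neighbour before the end.
    path-end⁻ : ∀ {x xs} → Path x xs → All (λ u → z ~ u → W u) (x ∷ xs) →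
                ∀ i → z ~ lookup (x ∷ xs) i → toℕ i ≡ length xs
    path-end⁻ (stop _ _)      _        zero    e = refl
    path-end⁻ (step ¬t _ _ _) (w ∷ _)  zero    e = contradiction (w e , e) ¬t
    path-end⁻ (step _ _ _ π)  (_ ∷ ws) (suc i) e = cong suc (path-end⁻ π ws i e)

    -- The path starts in `U` and, by `stop`, ends in `W`, so some edge passes from one to the
    -- other.
    path-crossing : ∀ {U : Pred (V G) 0ℓ} → (∀ {v} → U v → ¬ W v) →
                    ∀ {x xs} → Path x xs → All (U ∪ W) (x ∷ xs) → U x →
                    ∃₂ λ i j → U (lookup (x ∷ xs) i) × W (lookup (x ∷ xs) j) ×
                                     lookup (x ∷ xs) i ~ lookup (x ∷ xs) j
    path-crossing U⊥W (stop w _) _ u = contradiction w (U⊥W u)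
    path-crossing U⊥W (step _ x~y _ π) (_ ∷ inj₂ w ∷ _) u = zero , suc zero , u , w , x~y
    path-crossing U⊥W (step _ x~y _ π) (_ ∷ all@(inj₁ u′ ∷ _)) u =
      let i , j , rest = path-crossing U⊥W π all u′ in suc i , suc j , rest

  module _ {z : V G} {U W : Pred (V G) 0ℓ} (U? : Decidable U) (W? : Decidable W)
           (U⊥W : ∀ {v} → U v → ¬ W v) (z∉ : ¬ (U ∪ W) z) where

    -- An induced path is cut to its last vertex in `U` adjacent to `z`. Then only its first and
    -- last vertices are adjacent to `z`, and `z` closes it to an induced cycle.
    induced-cycle-through : ∀ {x y} → U x → z ~ x → Walk (U ∪ W) x y → W y → z ~ y →
      ∃ λ S → InducesCycle G S × (_∈ S) ⊆ (λ v → v ≡ z ⊎ (U ∪ W) v) × z ∈ S ×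
        ∃₂ λ u w → u ∈ S × w ∈ S × U u × W w × u ~ w
    induced-cycle-through u z~x walk w z~y
      with walk⇒path z W W? (inj₁ u) walk w z~y
    ... | _ , π₀ , all₀ with suffix z W (λ v → U? v ×-dec (z ~? v)) π₀ all₀
    ...   | inj₂ (¬first ∷ _) = contradiction (u , z~x) ¬first
    -- A one-vertex path would lie in both `U` and `W`, so the cycle has length at least 3.
    ...   | inj₁ (_ , [] , stop w′ _ , _ , (u′ , _) , _) = contradiction w′ (U⊥W u′)
    ...   | inj₁ (p , q ∷ qs , π@(step _ _ _ π′) , all@(_ ∷ all′) , (Up , z~p) , ¬first) =
      S , (length qs , f , f-injective , f-image , λ i j → mk⇔ (adj⁺ i j) (adj⁻ i j)) ,
      (λ v∈S → contained (∈-fromPred⁻ image? v∈S)) , f∈S zero ,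
      let i , j , Ui , Wj , e = path-crossing z W U⊥W π all Up in
      _ , _ , f∈S (suc i) , f∈S (suc j) , Ui , Wj , e
      where
      f : V Cycle[3+ length qs ] → V G
      f zero    = z
      f (suc i) = lookup (p ∷ q ∷ qs) i

      image? : Decidable (λ v → ∃ λ i → f i ≡ v)
      image? v = Fin.any? λ i → f i Fin.≟ v

      S = fromPred image?

      f∈S : ∀ i → f i ∈ S
      f∈S i = ∈-fromPred⁺ image? (i , refl)

      f-image : ∀ v → v ∈ S ⇔ ∃ λ i → f i ≡ v
      f-image v = mk⇔ (∈-fromPred⁻ image?) (∈-fromPred⁺ image?)

      in-UW : ∀ i → (U ∪ W) (f (suc i))
      in-UW i = All.lookup all (∈-lookup i)

      contained : ∀ {v} → (∃ λ i → f i ≡ v) → v ≡ z ⊎ (U ∪ W) v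
      contained (zero  , refl) = inj₁ refl
      contained (suc i , refl) = inj₂ (in-UW i)

      f-injective : Injective _≡_ _≡_ f
      f-injective {zero}  {zero}  _  = refl
      f-injective {zero}  {suc j} eq = ⊥-elim (z∉ (subst (U ∪ W) (sym eq) (in-UW j)))
      f-injective {suc i} {zero}  eq = ⊥-elim (z∉ (subst (U ∪ W) eq (in-UW i)))
      f-injective {suc i} {suc j} eq = cong suc (path-injective z W π eq)

      only-W : All (λ v → z ~ v → W v) (q ∷ qs)
      only-W = All.zipWith (λ (¬f , uw) z~v → [ (λ u → contradiction (u , z~v) ¬f) , (λ w → w) ]′ uw)
                           (¬first , all′)

      next⁺ : ∀ i j → Next i j → f i ~ f j
      next⁺ zero    (suc zero) (inj₁ eq) = z~p
      next⁺ (suc i) (suc j)    (inj₁ eq) = path-~⁺ z W π i j (ℕ.suc-injective eq)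
      next⁺ (suc (suc i)) zero (inj₂ (eq , _)) =
        ~-sym (path-end⁺ z W π′ i (ℕ.suc-injective (ℕ.suc-injective eq)))

      adj⁺ : ∀ i j → Next i j ⊎ Next j i → f i ~ f j
      adj⁺ i j (inj₁ n) = next⁺ i j n
      adj⁺ i j (inj₂ n) = ~-sym (next⁺ j i n)

      from-z : ∀ j → z ~ f j → Next zero j ⊎ Next j zero
      from-z zero e = ⊥-elim (~-irrefl refl e)
      from-z (suc zero) e = inj₁ (inj₁ refl)
      -- The tail `π′` is used because `p`, a neighbour of `z` in `U`, fails the condition in
      -- `only-W`.
      from-z (suc (suc j)) e = inj₂ (inj₂ (cong (2 +_) (path-end⁻ z W π′ only-W j e) , refl))

      adj⁻ : ∀ i j → f i ~ f j → Next i j ⊎ Next j i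
      adj⁻ zero    j       e = from-z j e
      adj⁻ (suc i) zero    e = swap (from-z (suc i) (~-sym e))
      adj⁻ (suc i) (suc j) e =
        Sum.map (inj₁ ∘ cong suc) (inj₁ ∘ cong suc) (path-~⁻ z W π i j e)

-- Counting by injections.

record AtLeast {A : Set} (n : ℕ) (P : Pred A 0ℓ) : Set where
  constructor distinct
  field
    witness   : Fin n → A
    injective : Injective _≡_ _≡_ witness
    satisfies : ∀ i → P (witness i)

-- `R` records which `x` a chosen `y` comes from; since `y` then determines `x`, the choices are
-- distinct.
atLeast-relabel : ∀ {A B : Set} {n} {P : Pred A 0ℓ} {Q : Pred B 0ℓ} (R : A → B → Set) →
                  (∀ {x} → P x → ∃ λ y → R x y × Q y) →
                  (∀ {x x′ y} → P x → P x′ → R x y → R x′ y → x ≡ x′) →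
                  AtLeast n P → AtLeast n Q
atLeast-relabel R choose R-inj (distinct f f-inj Pf) = distinct
  (λ i → proj₁ (choose (Pf i)))
  (λ {i} {j} eq → f-inj (R-inj (Pf i) (Pf j) (proj₁ (proj₂ (choose (Pf i))))
    (subst (R (f j)) (sym eq) (proj₁ (proj₂ (choose (Pf j)))))))
  (λ i → proj₂ (proj₂ (choose (Pf i))))

atLeast-mono : ∀ {A : Set} {n} {P Q : Pred A 0ℓ} → P ⊆ Q → AtLeast n P → AtLeast n Q
atLeast-mono P⊆Q (distinct f f-inj Pf) = distinct f f-inj λ i → P⊆Q (Pf i)

atLeast-∪ : ∀ {A : Set} {m n} {P Q : Pred A 0ℓ} → (∀ {x} → P x → ¬ Q x) →
            AtLeast m P → AtLeast n Q → AtLeast (m + n) (P ∪ Q)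
atLeast-∪ {A} {m} {n} {P} {Q} P⊥Q (distinct f f-inj Pf) (distinct g g-inj Qg) = distinct
  (fg ∘ splitAt m)
  (λ {i} {j} eq → splitAt-injective i j (fg-injective _ _ eq))
  (in-P∪Q ∘ splitAt m)
  where
  fg : Fin m ⊎ Fin n → A
  fg = [ f , g ]′

  fg-injective : ∀ s t → fg s ≡ fg t → s ≡ t
  fg-injective (inj₁ i) (inj₁ j) eq = cong inj₁ (f-inj eq)
  fg-injective (inj₁ i) (inj₂ j) eq = contradiction (Qg j) (P⊥Q (subst P eq (Pf i)))
  fg-injective (inj₂ i) (inj₁ j) eq = contradiction (subst Q eq (Qg i)) (P⊥Q (Pf j))
  fg-injective (inj₂ i) (inj₂ j) eq = cong inj₂ (g-inj eq)

  splitAt-injective : ∀ i j → splitAt m {n} i ≡ splitAt m j → i ≡ j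
  splitAt-injective i j eq =
    trans (sym (Fin.join-splitAt m n i)) (trans (cong (Fin.join m n) eq) (Fin.join-splitAt m n j))

  in-P∪Q : ∀ s → (P ∪ Q) (fg s)
  in-P∪Q (inj₁ i) = inj₁ (Pf i)
  in-P∪Q (inj₂ j) = inj₂ (Qg j)

atLeast-0 : ∀ {A : Set} {P : Pred A 0ℓ} → AtLeast 0 P
atLeast-0 = distinct (λ ()) (λ { {()} }) (λ ())

-- Increasing pairs encode the two-element subsets of `Fin k`.
Increasing : ∀ {k} → Pred (Fin k × Fin k) 0ℓ
Increasing (i , j) = i Fin.< j

-- Pascal's rule: pairs starting with `zero` contribute `k C 1`, and the others are shifts of the
-- pairs for `k`.
atLeast-increasing : ∀ k → AtLeast (k C 2) (Increasing {k})
atLeast-increasing zero    = atLeast-0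
atLeast-increasing (suc k) =
  subst (λ n → AtLeast n (Increasing {suc k})) (nCk+nC[k+1]≡[n+1]C[k+1] k 1)
    (atLeast-mono [ proj₂ , proj₂ ]′ (atLeast-∪ {P = from-0} {Q = from-suc}
      (λ (≡0 , _) (≢0 , _) → ≢0 ≡0)
      (subst (λ n → AtLeast n from-0) (sym (nC1≡n k))
        (distinct (λ j → zero , suc j) (λ { refl → refl }) (λ j → refl , s≤s z≤n)))
      (atLeast-relabel (λ (i , j) p → p ≡ (suc i , suc j)) (λ i<j → _ , refl , (λ ()) , s≤s i<j)
        (λ { _ _ refl refl → refl }) (atLeast-increasing k))))
  where
  from-0 from-suc : Pred (Fin (suc k) × Fin (suc k)) 0ℓ
  from-0   p = proj₁ p ≡ zero × Increasing p
  from-suc p = proj₁ p ≢ zero × Increasing p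

∈-subsets : ∀ {n} (S : Subset n) → S List.∈ subsets n
∈-subsets []            = here refl
∈-subsets (inside  ∷ S) = ∈-++⁺ˡ (∈-map⁺ (inside ∷_) (∈-subsets S))
∈-subsets (outside ∷ S) = ∈-++⁺ʳ _ (∈-map⁺ (outside ∷_) (∈-subsets S))

atLeast⇒≤∣C∣ : ∀ {G n} → AtLeast n (InducesCycle G) → n ≤ ∣C∣ G
atLeast⇒≤∣C∣ {G} (distinct f f-inj cyc) = Fin.injective⇒≤ {f = Any.index ∘ mem} λ {i} {j} eq →
  f-inj (trans (lookup-index (mem i))
    (trans (cong (lookup cycles) eq) (sym (lookup-index (mem j)))))
  where
  cycles = filter (inducesCycle? G) (subsets (order G))

  mem : ∀ i → f i List.∈ cycles
  mem i = ∈-filter⁺ (inducesCycle? G) (∈-subsets (f i)) (cyc i)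

nC-mono : ∀ k {m n} → m ≤ n → m C suc k ≤ n C suc k
nC-mono k m≤n = go (ℕ.≤⇒≤′ m≤n)
  where
  go : ∀ {m n} → m ≤′ n → m C suc k ≤ n C suc k
  go ≤′-refl = ℕ.≤-refl
  go (≤′-step {n} m≤n) = ℕ.≤-trans (go m≤n)
    (ℕ.≤-trans (ℕ.m≤n+m _ _) (ℕ.≤-reflexive (nCk+nC[k+1]≡[n+1]C[k+1] n k)))

-- Induced cycles meeting a connected set.

module _ (G : Graph) where
  open Graph G using (_~_; ~-sym; ~-irrefl; _~?_)

  Nbr : Pred (V G) 0ℓ → Pred (V G) 0ℓ
  Nbr A v = ∃ λ a → A a × v ~ a

  Linked : (A P Q : Pred (V G) 0ℓ) → Set
  Linked A P Q = ∃₂ λ x y → (P ∩ Nbr A) x × (Q ∩ Nbr A) y × Walk G (P ∪ Q) x y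

  CycleIn : Pred (V G) 0ℓ → Pred (Subset (order G)) 0ℓ
  CycleIn T S = InducesCycle G S × (_∈ S) ⊆ T

  last-exit : ∀ {X D : Pred (V G) 0ℓ} → Decidable D → ∀ {x y} → Walk G X x y → X y → ¬ D y →
              (X ∩ ∁ D) x × Walk G (X ∩ ∁ D) x y ⊎
              (∃₂ λ z w → X z × D z × z ~ w × (X ∩ ∁ D) w × Walk G (X ∩ ∁ D) w y)
  last-exit D? ε Xy ¬Dy = inj₁ ((Xy , ¬Dy) , ε)
  last-exit D? {x} ((Xx , _ , x~w) ◅ walk) Xy ¬Dy with last-exit D? walk Xy ¬Dy
  ... | inj₂ exit = inj₂ exit
  ... | inj₁ (w∉D , walk′) with D? x
  ...   | yes Dx = inj₂ (_ , _ , Xx , Dx , x~w , w∉D , walk′)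
  ...   | no ¬Dx = inj₁ ((Xx , ¬Dx) , ((Xx , ¬Dx) , w∉D , x~w) ◅ walk′)

  -- Let `z` be the last vertex of the walk in `P` with a neighbour in `A`. From there the walk goes
  -- on to `Q`, enters `A` and returns inside `A` to a neighbour of `z`. So `induced-cycle-through`
  -- applies, with `A` as its `W` and the part of `P ∪ Q` outside `P ∩ Nbr A` as its `U`.
  induced-cycle-meeting : ∀ {A P Q : Pred (V G) 0ℓ} → Decidable A → Decidable P → Decidable Q →
    (∀ {v} → A v → ¬ P v) → (∀ {v} → A v → ¬ Q v) → (∀ {v} → P v → ¬ Q v) →
    (∀ {a b} → A a → A b → Walk G A a b) → Linked A P Q →
    ∃ λ S → CycleIn (A ∪ (P ∪ Q)) S × (_∈ S) ≬ A × (_∈ S) ≬ P × (_∈ S) ≬ Q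
  induced-cycle-meeting {A} {P} {Q} A? P? Q? A⊥P A⊥Q P⊥Q A-connected
    (x , y , x∈D , (Qy , b , Ab , y~b) , walk)
    with last-exit D? walk (inj₂ Qy) (λ (Py , _) → P⊥Q Py Qy)
    where
    D? : Decidable (P ∩ Nbr A)
    D? v = P? v ×-dec Fin.any? λ a → A? a ×-dec (v ~? a)
  ... | inj₁ ((_ , x∉D) , _) = contradiction x∈D x∉D
  ... | inj₂ (z , w , _ , z∈D@(Pz , a , Aa , z~a) , z~w , w∈U , walk′) =
    let S , cyc , S⊆ , z∈S , u , a′ , u∈S , a′∈S , (u∈PQ , u∉D) , Aa′ , u~a′ =
          induced-cycle-through G U? A? U⊥A
            (λ { (inj₁ (_ , z∉D)) → z∉D z∈D ; (inj₂ Az) → A⊥P Az Pz })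
            w∈U z~w walk-to-a Aa z~a
    in S , (cyc , λ v∈S → [ (λ { refl → inj₂ (inj₁ Pz) }) , [ inj₂ ∘ proj₁ , inj₁ ]′ ]′ (S⊆ v∈S)) ,
       (a′ , a′∈S , Aa′) , (z , z∈S , Pz) ,
       -- `u` has the neighbour `a′` in `A` but lies outside `P ∩ Nbr A`, so it must be in `Q`.
       (u , u∈S , [ (λ Pu → contradiction (Pu , a′ , Aa′ , u~a′) u∉D) , (λ Qu → Qu) ]′ u∈PQ)
    where
    U : Pred (V G) 0ℓ
    U = (P ∪ Q) ∩ ∁ (P ∩ Nbr A)

    U? : Decidable U
    U? v = (P? v ⊎-dec Q? v) ×-dec ¬? (P? v ×-dec Fin.any? λ a → A? a ×-dec (v ~? a))

    U⊥A : ∀ {v} → U v → ¬ A v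
    U⊥A (pq , _) Av = [ A⊥P Av , A⊥Q Av ]′ pq

    walk-to-a : Walk G (U ∪ A) w a
    walk-to-a = walk-mono G inj₁ walk′ ◅◅
      (inj₁ (inj₂ Qy , λ (Py , _) → P⊥Q Py Qy) , inj₂ Ab , y~b) ◅
      walk-mono G inj₂ (A-connected Ab Aa)

  atLeast-cycles-step : ∀ {k} {T A : Pred (V G) 0ℓ} (Q : Fin k → Pred (V G) 0ℓ) →
    Decidable A → (∀ i → Decidable (Q i)) →
    (∀ {v} → A v → ¬ T v) → (∀ i → Q i ⊆ T) → (∀ {i j v} → Q i v → Q j v → i ≡ j) →
    (∀ {a b} → A a → A b → Walk G A a b) → (∀ i j → i ≢ j → Linked A (Q i) (Q j)) →
    AtLeast (k C 3) (CycleIn T) → AtLeast (suc k C 3) (CycleIn (T ∪ A))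
  atLeast-cycles-step {k} {T} {A} Q A? Q? A⊥T Q⊆T Q-disjoint A-connected linked old =
    subst (λ n → AtLeast n (CycleIn (T ∪ A))) (nCk+nC[k+1]≡[n+1]C[k+1] k 2)
      (atLeast-mono [ proj₁ , (λ (c , S⊆T) → c , inj₁ ∘ S⊆T) ]′
        (atLeast-∪ {P = λ S → CycleIn (T ∪ A) S × (_∈ S) ≬ A} {Q = CycleIn T}
          (λ (_ , a , a∈S , Aa) (_ , S⊆T) → A⊥T Aa (S⊆T a∈S)) new old))
    where
    Crosses : Fin k × Fin k → Pred (Subset (order G)) 0ℓ
    Crosses (i , j) S = (_∈ S) ⊆ A ∪ (Q i ∪ Q j) × (_∈ S) ≬ Q i × (_∈ S) ≬ Q j

    met : ∀ {i j l S} → (_∈ S) ⊆ A ∪ (Q i ∪ Q j) → (_∈ S) ≬ Q l → l ≡ i ⊎ l ≡ j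
    met S⊆ (v , v∈S , q) with S⊆ v∈S
    ... | inj₁ Av        = contradiction (Q⊆T _ q) (A⊥T Av)
    ... | inj₂ (inj₁ q′) = inj₁ (Q-disjoint q q′)
    ... | inj₂ (inj₂ q′) = inj₂ (Q-disjoint q q′)

    -- A set inside `A ∪ (Q i ∪ Q j)` can meet no third class, so both pairs have the same members,
    -- and the order fixes which comes first.
    crosses-injective : ∀ {p p′ S} → Increasing p → Increasing p′ →
                        Crosses p S → Crosses p′ S → p ≡ p′
    crosses-injective {S = S} i<j i′<j′ (S⊆ , _) (_ , meets-i′ , meets-j′)
      with met {S = S} S⊆ meets-i′ | met {S = S} S⊆ meets-j′
    ... | inj₁ refl | inj₂ refl = refl
    ... | inj₁ refl | inj₁ refl = contradiction i′<j′ (Fin.<-irrefl refl)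
    ... | inj₂ refl | inj₂ refl = contradiction i′<j′ (Fin.<-irrefl refl)
    ... | inj₂ refl | inj₁ refl = contradiction i<j (Fin.<-asym i′<j′)

    new : AtLeast (k C 2) (λ S → CycleIn (T ∪ A) S × (_∈ S) ≬ A)
    new = atLeast-relabel Crosses
      (λ {(i , j)} i<j →
        let S , (cyc , S⊆) , S≬A , S≬i , S≬j =
              induced-cycle-meeting A? (Q? i) (Q? j)
                (λ Av → A⊥T Av ∘ Q⊆T i)
                (λ Av → A⊥T Av ∘ Q⊆T j)
                (λ qi qj → Fin.<⇒≢ i<j (Q-disjoint qi qj)) A-connected (linked i j (Fin.<⇒≢ i<j))
        in S , (S⊆ , S≬i , S≬j) ,
           (cyc , λ v∈S → [ inj₂ , inj₁ ∘ [ Q⊆T i , Q⊆T j ]′ ]′ (S⊆ v∈S)) , S≬A)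
      (λ {p} {p′} {S} → crosses-injective {p} {p′} {S})
      (atLeast-increasing k)

  -- Clique minors.

  clique-model⇒cycles : ∀ t B → IsModel (K t) G B →
    AtLeast (t C 3) (CycleIn (λ v → ∃ λ x → v ∈ B x))
  clique-model⇒cycles zero    B _ = atLeast-0
  clique-model⇒cycles (suc t) B (conn , disj , adj) =
    atLeast-mono
      (λ (cyc , S⊆) → cyc , λ v∈S →
        [ (λ (x , v∈) → suc x , v∈) , (λ v∈ → zero , v∈) ]′ (S⊆ v∈S))
      (atLeast-cycles-step (λ x → _∈ B (suc x)) (_∈? B zero) (λ x → _∈? B (suc x))
        (λ { v∈₀ (x , v∈ₓ) → Fin.0≢1+n (disj _ _ _ v∈₀ v∈ₓ) })
        (λ x v∈ → x , v∈)
        (λ p q → Fin.suc-injective (disj _ _ _ p q))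
        (λ p q → proj₂ (conn zero) _ _ p q)
        linked
        (clique-model⇒cycles t (B ∘ suc)
          (conn ∘ suc ,
           (λ x y v p q → Fin.suc-injective (disj _ _ v p q)) ,
           (λ x y x≢y → adj _ _ (x≢y ∘ Fin.suc-injective)))))
    where
    linked : ∀ x y → x ≢ y → Linked (_∈ B zero) (_∈ B (suc x)) (_∈ B (suc y))
    linked x y x≢y =
      -- The walk runs through `B (suc x)` from a neighbour of `B zero` to an edge joining the two
      -- branch sets, then through `B (suc y)` to another neighbour of `B zero`.
      let a , u , a∈ , u∈ , a~u = adj zero (suc x) λ ()
          b , v , b∈ , v∈ , b~v = adj zero (suc y) λ ()
          p , q , p∈ , q∈ , p~q = adj (suc x) (suc y) (x≢y ∘ Fin.suc-injective)
      in u , v , (u∈ , a , a∈ , ~-sym a~u) , (v∈ , b , b∈ , ~-sym b~v) ,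
         walk-mono G inj₁ (proj₂ (conn (suc x)) _ _ u∈ p∈) ◅◅
         (inj₁ p∈ , inj₂ q∈ , p~q) ◅
         walk-mono G inj₂ (proj₂ (conn (suc y)) _ _ q∈ v∈)

-- Colourings and Kempe chains.

-- Finitely many appeals to excluded middle can be made at once when the goal is a negation.
¬¬-∀ : ∀ {n} {P : Pred (Fin n) 0ℓ} → (∀ i → ¬ ¬ P i) → ¬ ¬ (∀ i → P i)
¬¬-∀ = Fin.sequence (RawMonad.rawApplicative ¬¬-Monad)

module _ (G : Graph) where
  open Graph G using (_~_; ~-sym; ~-irrefl; _~?_)

  ProperOn : ∀ {k} → Pred (V G) 0ℓ → (V G → Fin k) → Set
  ProperOn T c = ∀ {u v} → T u → T v → u ~ v → c u ≢ c v

  ColourableOn : Pred (V G) 0ℓ → ℕ → Set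
  ColourableOn T k = ∃ λ (c : V G → Fin k) → ProperOn T c

  extend-colouring : ∀ {k T v} (c : V G → Fin k) → ProperOn T c →
    ∀ i → (∀ {u} → T u → v ~ u → c u ≢ i) → ColourableOn (T ∪ ｛ v ｝) k
  extend-colouring {k} {T} {v} c proper i free = c′ , proper′
    where
    recolour : ∀ {u} → Dec (v ≡ u) → Fin k
    recolour     (yes _) = i
    recolour {u} (no  _) = c u

    c′ : V G → Fin k
    c′ u = recolour (v Fin.≟ u)

    T-of : ∀ {u} → (T ∪ ｛ v ｝) u → v ≢ u → T u
    T-of (inj₁ t)   _   = t
    T-of (inj₂ v≡u) v≢u = contradiction v≡u v≢u

    proper′ : ProperOn (T ∪ ｛ v ｝) c′
    proper′ {u} {w} u∈ w∈ u~w with v Fin.≟ u | v Fin.≟ w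
    ... | yes refl | yes refl = contradiction u~w (~-irrefl refl)
    ... | yes refl | no v≢w   = free (T-of w∈ v≢w) u~w ∘ sym
    ... | no v≢u   | yes refl = free (T-of u∈ v≢u) (~-sym u~w)
    ... | no v≢u   | no v≢w   = proper (T-of u∈ v≢u) (T-of w∈ v≢w) u~w

  Class : ∀ {k} → Pred (V G) 0ℓ → (V G → Fin k) → Fin k → Pred (V G) 0ℓ
  Class T c i u = T u × c u ≡ i

  -- Kempe's argument: otherwise exchanging i and j on everything reachable from the
  -- i-coloured neighbours of v would free colour i for v.
  classes-linked : ∀ {k T v} (c : V G → Fin k) → ProperOn T c → ¬ ColourableOn (T ∪ ｛ v ｝) k →
    ∀ i j → i ≢ j → ¬ ¬ Linked G ｛ v ｝ (Class T c i) (Class T c j)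
  classes-linked {k} {T} {v} c proper ¬col i j i≢j ¬linked =
    -- Reachability is decided for all vertices at once, under double negation.
    ¬¬-∀ (λ u → ¬¬-excluded-middle) λ reach? →
    ¬col (extend-colouring (λ u → recolour (reach? u))
      (λ {u} {w} u∈T w∈T u~w → recolour-proper (reach? u) (reach? w) u∈T w∈T u~w)
      i (λ {u} u∈T v~u → i-free (reach? u) u∈T v~u))
    where
    X : Pred (V G) 0ℓ
    X = Class T c i ∪ Class T c j

    Reach : Pred (V G) 0ℓ
    Reach u = ∃ λ s → (Class T c i ∩ Nbr G ｛ v ｝) s × Walk G X s u

    reach⇒X : ∀ {u} → Reach u → X u
    reach⇒X (s , (s∈i , _) , walk) = go (inj₁ s∈i) walk
      where
      go : ∀ {x y} → X x → Walk G X x y → X y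
      go Xx ε                   = Xx
      go Xx ((_ , Xy , _) ◅ walk) = go Xy walk

    -- It is applied only to colours of reached vertices, which are `i` or `j`; on these it is the
    -- transposition.
    flip-colour : Fin k → Fin k
    flip-colour x with x Fin.≟ i
    ... | yes _ = j
    ... | no  _ = i

    flip-i : ∀ {x} → x ≡ i → flip-colour x ≡ j
    flip-i {x} x≡i with x Fin.≟ i
    ... | yes _   = refl
    ... | no x≢i = contradiction x≡i x≢i

    flip-j : ∀ {x} → x ≡ j → flip-colour x ≡ i
    flip-j {x} x≡j with x Fin.≟ i
    ... | yes x≡i = contradiction (trans (sym x≡i) x≡j) i≢j
    ... | no _    = refl

    recolour : ∀ {u} → Dec (Reach u) → Fin k
    recolour {u} (yes _) = flip-colour (c u)
    recolour {u} (no  _) = c u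

    reach-neighbour : ∀ {u w} → Reach u → X w → u ~ w → Reach w
    reach-neighbour r@(s , s∈ , walk) Xw u~w =
      s , s∈ , walk ◅◅ (reach⇒X r , Xw , u~w) ◅ ε

    -- If the flipped colour agreed with `c w`, then `w` would have colour `i` or `j` and prolong
    -- the Kempe chain, hence be reached.
    boundary : ∀ {u w} → Reach u → ¬ Reach w → T w → u ~ w → flip-colour (c u) ≢ c w
    boundary r ¬r w∈T u~w eq with reach⇒X r
    ... | inj₁ (_ , cu≡i) =
      ¬r (reach-neighbour r (inj₂ (w∈T , trans (sym eq) (flip-i cu≡i))) u~w)
    ... | inj₂ (_ , cu≡j) =
      ¬r (reach-neighbour r (inj₁ (w∈T , trans (sym eq) (flip-j cu≡j))) u~w)

    recolour-proper : ∀ {u w} (r : Dec (Reach u)) (s : Dec (Reach w)) → T u → T w → u ~ w →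
                      recolour r ≢ recolour s
    recolour-proper (no _)   (no _)   u∈T w∈T u~w eq = proper u∈T w∈T u~w eq
    recolour-proper (yes ru) (no ¬rw) u∈T w∈T u~w eq = boundary ru ¬rw w∈T u~w eq
    recolour-proper (no ¬ru) (yes rw) u∈T w∈T u~w eq = boundary rw ¬ru u∈T (~-sym u~w) (sym eq)
    recolour-proper (yes ru) (yes rw) u∈T w∈T u~w eq with reach⇒X ru | reach⇒X rw
    ... | inj₁ (_ , p) | inj₁ (_ , q) = proper u∈T w∈T u~w (trans p (sym q))
    ... | inj₂ (_ , p) | inj₂ (_ , q) = proper u∈T w∈T u~w (trans p (sym q))
    ... | inj₁ (_ , p) | inj₂ (_ , q) = i≢j (trans (sym (flip-j q)) (trans (sym eq) (flip-i p)))
    ... | inj₂ (_ , p) | inj₁ (_ , q) = i≢j (trans (sym (flip-j p)) (trans eq (flip-i q)))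

    i-free : ∀ {u} (r : Dec (Reach u)) → T u → v ~ u → recolour r ≢ i
    i-free {u} (no ¬r) u∈T v~u cu≡i =
      ¬r (u , ((u∈T , cu≡i) , v , refl , ~-sym v~u) , ε)
    i-free {u} (yes r@(s , s∈ , walk)) u∈T v~u eq with reach⇒X r
    ... | inj₁ (_ , cu≡i) = i≢j (trans (sym eq) (flip-i cu≡i))
    -- A reached neighbour of `v` of colour `j` ends a Kempe chain that links the two classes.
    ... | inj₂ u∈j        = ¬linked (s , u , s∈ , (u∈j , v , refl , ~-sym v~u) , walk)

  -- Failing `k` colours means that at least `k + 1` are required, hence `suc k`. The double
  -- negation leaves room for excluded middle.
  ManyCycles : Pred (V G) 0ℓ → Set
  ManyCycles T = ∀ k → ¬ ColourableOn T k → ¬ ¬ AtLeast (suc k C 3) (CycleIn G T)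

  many-cycles-step : ∀ {T v} → Decidable T → ¬ T v → ManyCycles T → ManyCycles (T ∪ ｛ v ｝)
  -- `1 C 3` is 0.
  many-cycles-step T? v∉T many zero _ ¬cycles = ¬cycles atLeast-0
  many-cycles-step {T} {v} T? v∉T many (suc k) ¬col ¬cycles = ¬¬-excluded-middle λ where
      -- If `T` already fails `suc k` colours, its own cycles suffice.
      (no ¬colT) → many (suc k) ¬colT
        (¬cycles ∘′ atLeast-mono (λ (cyc , S⊆) → cyc , inj₁ ∘′ S⊆))
      -- A `k`-colouring of `T` would leave a fresh colour for `v`, so `T` has `suc k C 3` cycles;
      -- the `suc k` classes of `c`, pairwise linked through `v`, supply the rest.
      (yes (c , proper)) → many k
        (λ (c′ , proper′) → ¬col (extend-colouring (suc ∘ c′)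
          (λ u∈ w∈ u~w → proper′ u∈ w∈ u~w ∘ Fin.suc-injective) zero (λ _ _ ())))
        λ cycles → ¬¬-∀ (λ i → ¬¬-∀ (λ j → linked c proper i j)) λ link →
          ¬cycles (atLeast-cycles-step G (Class T c) (v Fin.≟_)
            (λ i u → T? u ×-dec (c u Fin.≟ i))
            (λ { refl → v∉T }) (λ _ → proj₁) (λ (_ , p) (_ , q) → trans (sym p) q)
            (λ { refl refl → ε }) link cycles)
    where
    linked : ∀ (c : V G → Fin (suc k)) (proper : ProperOn T c) i j →
             ¬ ¬ (i ≢ j → Linked G ｛ v ｝ (Class T c i) (Class T c j))
    linked c proper i j ¬link with i Fin.≟ j
    ... | yes i≡j = ¬link (contradiction i≡j)
    ... | no i≢j  = classes-linked c proper ¬col i j i≢j λ l → ¬link λ _ → l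

  Below : ℕ → Pred (V G) 0ℓ
  Below m v = toℕ v < m

  many-cycles : ∀ m → m ≤ order G → ManyCycles (Below m)
  many-cycles zero    _   zero    _    ¬cycles = ¬cycles atLeast-0
  -- `Below zero` is empty, so a constant colouring is proper on it.
  many-cycles zero    _   (suc k) ¬col _       = ¬col ((λ _ → zero) , λ ())
  many-cycles (suc m) m<n k       ¬col ¬cycles =
    many-cycles-step (λ u → toℕ u ℕ.<? m) (ℕ.<-irrefl (Fin.toℕ-fromℕ< m<n))
      (many-cycles m (ℕ.<⇒≤ m<n)) k
      (λ (c , proper) → ¬col (c , λ u∈ w∈ → proper (split u∈) (split w∈)))
      (¬cycles ∘′ atLeast-mono (λ (cyc , S⊆) → cyc , join ∘′ S⊆))
    where
    v = fromℕ< m<n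

    split : Below (suc m) ⊆ Below m ∪ ｛ v ｝
    split u<1+m with ℕ.m≤n⇒m<n∨m≡n (ℕ.m<1+n⇒m≤n u<1+m)
    ... | inj₁ u<m  = inj₁ u<m
    ... | inj₂ u≡m = inj₂ (Fin.toℕ-injective (trans (Fin.toℕ-fromℕ< m<n) (sym u≡m)))

    join : Below m ∪ ｛ v ｝ ⊆ Below (suc m)
    join (inj₁ u<m)  = ℕ.m<n⇒m<1+n u<m
    join (inj₂ refl) = ℕ.≤-reflexive (cong suc (Fin.toℕ-fromℕ< m<n))

  -- Bounds on the Hadwiger and chromatic numbers.

  clique-minor⇒nC3≤∣C∣ : ∀ n → K n ≼ G → n C 3 ≤ ∣C∣ G
  clique-minor⇒nC3≤∣C∣ n (B , model) =
    atLeast⇒≤∣C∣ {G} (atLeast-mono proj₁ (clique-model⇒cycles G n B model))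

  ¬colourable⇒nC3≤∣C∣ : ∀ k → ¬ Colourable G k → suc k C 3 ≤ ∣C∣ G
  -- The inequality is decidable, so the double negation in `many-cycles` can be removed.
  ¬colourable⇒nC3≤∣C∣ k ¬col = decidable-stable (_ ℕ.≤? _) λ ¬≤ →
    many-cycles (order G) ℕ.≤-refl k
      (λ (c , proper) → ¬col (c , λ u w → proper (Fin.toℕ<n u) (Fin.toℕ<n w)))
      (¬≤ ∘ atLeast⇒≤∣C∣ {G} ∘′ atLeast-mono proj₁)

theorem5p1p1 : (G : Graph) → Connected G → (n : ℕ) → 0 < n → ∣C∣ G < n C 3 → χ G ⊔ h G < n
theorem5p1p1 G _ (suc k) _ few = ℕ.⊔-pres-<m (s≤s χ≤k) h<n
  where
  -- With `n` equal to `suc k`, it suffices to colour with `k` colours; colourability is decidable,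
  -- so this can be proved by contradiction.
  χ≤k : χ G ≤ k
  χ≤k = proj₂ (χ-isLeast G) k (decidable-stable (colourable? G k) λ ¬col →
    ℕ.<⇒≱ few (¬colourable⇒nC3≤∣C∣ G k ¬col))

  h<n : h G < suc k
  -- A `K (h G)` minor gives `h G C 3` cycles, too many if `suc k ≤ h G`.
  h<n = ℕ.≰⇒> λ n≤h → ℕ.<⇒≱ few
    (ℕ.≤-trans (nC-mono 2 n≤h) (clique-minor⇒nC3≤∣C∣ G (h G) (proj₁ (h-isGreatest G))))
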